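{- Let $p$ be a prime and let $G^+$ be a finite $p$-group. Then $G^+$ satisfies property $\mathcal P^+(p)$ if and only if there exists $x\in G^+$ such that the subgroup $\langle x^p\rangle$ is not normal in $G^+$.
   Context: For a finite group $\Gamma$, $\ell\ge1$ and $x\in\Gamma$, $r_\ell(x)=|\{g\in\Gamma:g^\ell=x\}|$. A subgroup $G$ satisfies $\mathcal P(p)$ relative to $(a,b)$ if $a,b\in G$ have the same order, $0=r_p(a)<r_p(b)$ (roots counted in $G$), and $r_\ell(a)=r_\ell(b)$ for every square-free integer $1<\ell<p$. $G^+$ satisfies $\mathcal P^+(p)$ if there exist $a,b\in G^+$ conjugate in $G^+$ and a subgroup $G\subset G^+$ containing $a,b$ such that $G$ satisfies $\mathcal P(p)$ relative to $(a,b)$. -}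

module Defs where

open import Data.Nat using (ℕ; zero; suc; _+_; _*_; _^_; _≤_; _<_)
open import Data.Nat.Divisibility using (_∣_)
open import Data.Nat.Primality using (Prime)
open import Data.Fin using (Fin)
open import Data.Fin.Properties using (_≟_)
open import Data.Bool using (Bool; true; false; if_then_else_; _∧_; T)
open import Data.List using (List; map)
open import Data.Nat.ListAction using (sum)
open import Data.List.Base using (allFin)
open import Data.Product using (Σ; ∃; ∃-syntax; _×_; _,_)
open import Relation.Nullary using (¬_; Dec; does)
open import Relation.Binary.PropositionalEquality using (_≡_; _≢_)

-- A finite group, presented (up to isomorphism) on the carrier Fin size
-- by its multiplication table, with propositional equality.
record FinGroup : Set where
  field
    size  : ℕ
    _·_   : Fin size → Fin size → Fin size
    e     : Fin size
    inv   : Fin size → Fin size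
    assoc : ∀ x y z → (x · y) · z ≡ x · (y · z)
    idˡ   : ∀ x → e · x ≡ x
    idʳ   : ∀ x → x · e ≡ x
    invˡ  : ∀ x → inv x · x ≡ e
    invʳ  : ∀ x → x · inv x ≡ e

module _ (G : FinGroup) where
  open FinGroup G

  Elt : Set
  Elt = Fin size

  pow : Elt → ℕ → Elt
  pow x zero    = e
  pow x (suc k) = x · pow x k

  IsOrder : Elt → ℕ → Set
  IsOrder x k = 1 ≤ k × pow x k ≡ e × (∀ j → 1 ≤ j → j < k → pow x j ≢ e)

  SameOrder : Elt → Elt → Set
  SameOrder a b = ∃[ k ] (IsOrder a k × IsOrder b k)

  record Subgroup : Set where
    field
      mem    : Elt → Bool
      has-e  : T (mem e)
      closed : ∀ x y → T (mem x) → T (mem y) → T (mem (x · y))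
      inv-cl : ∀ x → T (mem x) → T (mem (inv x))

  roots : Subgroup → ℕ → Elt → ℕ
  roots H ℓ x =
    sum (map (λ g → if Subgroup.mem H g ∧ does (pow g ℓ ≟ x) then 1 else 0)
             (allFin size))

  Conjugate : Elt → Elt → Set
  Conjugate a b = ∃[ g ] (b ≡ (g · a) · inv g)

  InCyclic : Elt → Elt → Set
  InCyclic y h = ∃[ k ] (h ≡ pow y k)

  NormalCyclic : Elt → Set
  NormalCyclic y = ∀ g h → InCyclic y h → InCyclic y ((g · h) · inv g)

SquareFree : ℕ → Set
SquareFree ℓ = ∀ d → 1 < d → ¬ ((d * d) ∣ ℓ)

IsPGroup : ℕ → FinGroup → Set
IsPGroup p G = ∃[ k ] (FinGroup.size G ≡ p ^ k)

PropP : (G : FinGroup) → ℕ → Subgroup G → Elt G → Elt G → Set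
PropP G p H a b =
  T (Subgroup.mem H a) × T (Subgroup.mem H b) ×
  SameOrder G a b ×
  roots G H p a ≡ 0 × 0 < roots G H p b ×
  (∀ ℓ → 1 < ℓ → ℓ < p → SquareFree ℓ → roots G H ℓ a ≡ roots G H ℓ b)

PropP⁺ : ℕ → FinGroup → Set
PropP⁺ p G⁺ = ∃[ a ] ∃[ b ] (Conjugate G⁺ a b × ∃[ H ] PropP G⁺ p H a b)

{-# OPTIONS --safe #-}
-- If b = xᵖ and ⟨b⟩ is normal, every conjugate of b is a power bⁱ = (xⁱ)ᵖ, hence a p-th
-- power in any subgroup containing x. Conversely let b = xᵖ have a conjugate a outside ⟨b⟩.
-- Then a is not in ⟨x⟩ either: otherwise a, not being a p-th power in ⟨x⟩, generates ⟨x⟩,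
-- so b is a power of aᵖ, which has smaller order than b unless b = e. Normalizers grow in
-- p-groups, so iterating K ↦ N(K) from ⟨x⟩ yields K containing x but not a with a ∈ N(K).
-- In H = K⟨a⟩ the element b has the p-th root x. But a has none: from yᵖ = a and y ∈ K aⁱ
-- one gets y ^ (1 - i p) ∈ K, hence y ∈ K and a ∈ K. For l < p every element of H has exactly
-- one l-th root in H.
-- The growth of normalizers follows from counting double cosets: if N(K) = K, then p |K|
-- divides |K x K| for every x outside K, and it divides |G| if K ≠ G, hence also |K|.
module Submission where

open import Defs
open import Data.Nat hiding (_≟_)
open import Data.Nat.Primality using (Prime; prime⇒irreducible; prime⇒nonTrivial)
open import Data.Product
open import Relation.Nullary
open import Function.Bundles using (_⇔_; mk⇔)
open import Algebra.Bundles using (Group)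
open import Data.Bool using (if_then_else_; T)
open import Data.Fin using (Fin; zero; suc; toℕ; fromℕ<)
open import Data.Fin.Permutation using (permutation)
open import Data.Fin.Properties using
  (_≟_; any?; all?; ¬∀⟶∃¬; pigeonhole; suc-injective; toℕ<n; toℕ-fromℕ<; toℕ-injective)
open import Data.List using (tabulate)
open import Data.List.Properties using (map-tabulate)
open import Data.Nat.Coprimality using (Coprime; coprime-Bézout; coprime-divisor)
open import Data.Nat.DivMod using (m≡m%n+[m/n]*n; m%n<n)
open import Data.Nat.Divisibility
open import Data.Nat.GCD using (module Bézout)
open import Data.Nat.Induction using (<-wellFounded)
open import Data.Nat.ListAction using () renaming (sum to sumₗ)
open import Data.Nat.Properties hiding (suc-injective; _≟_)
open import Data.Nat.Tactic.RingSolver using (solve-∀)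
open import Data.Sum using (inj₁; inj₂)
open import Data.Unit using (tt)
open import Function using (_∘_; id)
open import Induction.WellFounded using (Acc; acc)
open import Level using (0ℓ)
open import Relation.Binary.PropositionalEquality
open import Relation.Nullary.Decidable
open import Relation.Unary using (Pred; Decidable)
open import Algebra.Properties.CommutativeMonoid.Sum +-0-commutativeMonoid
  using (sum; sum-syntax; ∑-distrib-+; ∑-comm; ∑-permute; sum-cong-≗)

-- Arithmetic of prime powers

-- A common divisor d of m and p ^ (1 + k) is coprime to p, since p does not divide m; hence d
-- already divides p ^ k.
coprime-^ : ∀ {p m} → Prime p → ¬ p ∣ m → ∀ k → Coprime m (p ^ k)
coprime-^ pp p∤m zero (_ , d∣1) = ∣1⇒≡1 d∣1
coprime-^ {p} {m} pp p∤m (suc k) {d} (d∣m , d∣p^1+k) =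
  coprime-^ pp p∤m k (d∣m , coprime-divisor coprime-d-p d∣p^1+k)
  where
  coprime-d-p : Coprime d p
  coprime-d-p (c∣d , c∣p) with prime⇒irreducible pp c∣p
  ... | inj₁ c≡1 = c≡1
  ... | inj₂ refl = contradiction (∣-trans c∣d d∣m) p∤m

-- Bézout gives the inverse up to sign. The congruence is an equation in `ℕ` because u and v end up
-- in exponents of `pow`.
inverse-mod-^ : ∀ {p m} → Prime p → ¬ p ∣ m → ∀ k →
                ∃₂ λ u v → m * u ≡ 1 + p ^ k * v
inverse-mod-^ {m = zero} pp p∤m k = contradiction (_ ∣0) p∤m
inverse-mod-^ {p} {m@(suc m′)} pp p∤m k with coprime-Bézout (coprime-^ pp p∤m k)
... | Bézout.+- x y eq =
  x , y , trans (*-comm m x) (trans (sym eq) (cong suc (*-comm y (p ^ k))))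
-- Here -x is an inverse of m; x²m + 2yN, with N = p ^ k, is congruent to it.
... | Bézout.-+ x y eq = x * m * x + 2 * (y * N) , y * y * N + 2 * y * m′ , (begin
  m * (x * m * x + 2 * (y * N))               ≡⟨ cong (λ t → m * (x * m * x + 2 * t)) eq ⟨
  m * (x * m * x + 2 * (1 + x * m))           ≡⟨ expand m′ x ⟩
  1 + (1 + x * m) * ((1 + x * m) + 2 * m′)    ≡⟨ cong (λ t → 1 + t * (t + 2 * m′)) eq ⟩
  1 + (y * N) * ((y * N) + 2 * m′)            ≡⟨ regroup m′ y N ⟩
  1 + N * (y * y * N + 2 * y * m′)            ∎)
  where
  open ≡-Reasoning
  N = p ^ k
  expand : ∀ m′ x → suc m′ * (x * suc m′ * x + 2 * (1 + x * suc m′)) ≡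
           1 + (1 + x * suc m′) * ((1 + x * suc m′) + 2 * m′)
  expand = solve-∀
  regroup : ∀ m′ y N → 1 + (y * N) * ((y * N) + 2 * m′) ≡ 1 + N * (y * y * N + 2 * y * m′)
  regroup = solve-∀

prime-∣-divisor-^ : ∀ {p q} → Prime p → ∀ k → q ∣ p ^ k → q ≢ 1 → p ∣ q
prime-∣-divisor-^ {p} {q} pp k q∣p^k q≢1 with p ∣? q
... | yes p∣q = p∣q
... | no p∤q = contradiction (coprime-^ pp p∤q k (∣-refl , q∣p^k)) q≢1

-- The cofactor m / d divides p ^ k and is not 1, so p divides it. Applied to orders of subgroups, a
-- proper inclusion thus yields a factor p.
prime*properDivisor-∣ : ∀ {p d m} → Prime p → ∀ k → m ∣ p ^ k → d ∣ m → d ≢ m → p * d ∣ m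
prime*properDivisor-∣ {p} {d} pp k m∣p^k (divides q refl) d≢m =
  *-monoˡ-∣ {p} {q} d (prime-∣-divisor-^ pp k (∣-trans (m∣m*n d) m∣p^k) λ { refl → d≢m (sym (+-identityʳ d)) })

-- Counting

-- Iverson bracket, in the same `if_then_else_` form as the summand of `roots`, so that the two
-- agree definitionally.
⟦_⟧ : ∀ {A : Set} → Dec A → ℕ
⟦ a? ⟧ = if does a? then 1 else 0

⟦⟧-yes : ∀ {A : Set} (a? : Dec A) → A → ⟦ a? ⟧ ≡ 1
⟦⟧-yes (yes _) _ = refl
⟦⟧-yes (no ¬a) a = contradiction a ¬a

⟦⟧-no : ∀ {A : Set} (a? : Dec A) → ¬ A → ⟦ a? ⟧ ≡ 0
⟦⟧-no (yes a) ¬a = contradiction a ¬a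
⟦⟧-no (no _) _ = refl

⟦⟧-cong : ∀ {A B : Set} (a? : Dec A) (b? : Dec B) → (A → B) → (B → A) → ⟦ a? ⟧ ≡ ⟦ b? ⟧
⟦⟧-cong (yes a) b? f g = sym (⟦⟧-yes b? (f a))
⟦⟧-cong (no ¬a) b? f g = sym (⟦⟧-no b? (¬a ∘ g))

private variable
  m n : ℕ
  P Q : Pred (Fin n) 0ℓ

count : Decidable {A = Fin n} P → ℕ
count {n = n} P? = ∑[ i < n ] ⟦ P? i ⟧

count-cong : (P? : Decidable P) (Q? : Decidable Q) →
             (∀ i → P i → Q i) → (∀ i → Q i → P i) → count P? ≡ count Q?
count-cong P? Q? f g = sum-cong-≗ λ i → ⟦⟧-cong (P? i) (Q? i) (f i) (g i)

count-none : (P? : Decidable {A = Fin n} P) → (∀ i → ¬ P i) → count P? ≡ 0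
count-none {n = zero} P? ¬P = refl
count-none {n = suc n} P? ¬P =
  cong₂ _+_ (⟦⟧-no (P? zero) (¬P zero)) (count-none (P? ∘ suc) (¬P ∘ suc))

count-all : (P? : Decidable {A = Fin n} P) → (∀ i → P i) → count P? ≡ n
count-all {n = zero} P? all = refl
count-all {n = suc n} P? all =
  cong₂ _+_ (⟦⟧-yes (P? zero) (all zero)) (count-all (P? ∘ suc) (all ∘ suc))

count-unique : (P? : Decidable {A = Fin n} P) (c : Fin n) → P c →
               (∀ i → P i → i ≡ c) → count P? ≡ 1
count-unique P? zero Pc uniq =
  cong₂ _+_ (⟦⟧-yes (P? zero) Pc) (count-none (P? ∘ suc) λ i Pi → contradiction (uniq (suc i) Pi) λ ())
count-unique P? (suc c) Pc uniq =
  cong₂ _+_ (⟦⟧-no (P? zero) λ P0 → contradiction (uniq zero P0) λ ())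
            (count-unique (P? ∘ suc) c Pc λ i Pi → suc-injective (uniq (suc i) Pi))

count-pos : (P? : Decidable {A = Fin n} P) (c : Fin n) → P c → 0 < count P?
count-pos P? zero Pc rewrite ⟦⟧-yes (P? zero) Pc = s≤s z≤n
count-pos P? (suc c) Pc = ≤-trans (count-pos (P? ∘ suc) c Pc) (m≤n+m _ ⟦ P? zero ⟧)

count-pos⁻¹ : (P? : Decidable {A = Fin n} P) → 0 < count P? → ∃ P
count-pos⁻¹ P? 0<c with any? P?
... | yes p = p
... | no ¬p = contradiction (count-none P? λ i Pi → ¬p (i , Pi)) (m<n⇒n≢0 0<c)

count-split : (P? : Decidable {A = Fin n} P) (Q? : Decidable {A = Fin n} Q) →
              count P? ≡ count (λ i → P? i ×-dec Q? i) + count (λ i → P? i ×-dec ¬? (Q? i))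
count-split P? Q? = trans (sum-cong-≗ λ i → split (P? i) (Q? i))
  (∑-distrib-+ (λ i → ⟦ P? i ×-dec Q? i ⟧) (λ i → ⟦ P? i ×-dec ¬? (Q? i) ⟧))
  where
  split : ∀ {A B : Set} (a? : Dec A) (b? : Dec B) → ⟦ a? ⟧ ≡ ⟦ a? ×-dec b? ⟧ + ⟦ a? ×-dec ¬? b? ⟧
  split (yes _) (yes _) = refl
  split (yes _) (no _) = refl
  split (no _) _ = refl

count-remove : (P? : Decidable {A = Fin n} P) (Q? : Decidable {A = Fin n} Q) → (∀ i → P i → Q i) →
              count Q? ≡ count P? + count (λ i → Q? i ×-dec ¬? (P? i))
count-remove P? Q? P⊆Q = trans (count-split Q? P?)
  (cong (_+ count (λ i → Q? i ×-dec ¬? (P? i)))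
    (count-cong (λ i → Q? i ×-dec P? i) P? (λ _ → proj₂) λ i Pi → P⊆Q i Pi , Pi))

count-strict : (P? : Decidable {A = Fin n} P) (Q? : Decidable {A = Fin n} Q) → (∀ i → P i → Q i) →
               ∀ c → Q c → ¬ P c → count P? < count Q?
count-strict P? Q? P⊆Q c Qc ¬Pc rewrite count-remove P? Q? P⊆Q =
  m<m+n (count P?) (count-pos (λ i → Q? i ×-dec ¬? (P? i)) c (Qc , ¬Pc))

count-bijection : (P? : Decidable {A = Fin n} P) (f g : Fin n → Fin n) →
                  (∀ x → f (g x) ≡ x) → (∀ x → g (f x) ≡ x) → count (P? ∘ f) ≡ count P?
count-bijection P? f g fg gf = sym (∑-permute (λ i → ⟦ P? i ⟧) (permutation f g fg gf))

∑-const-on : (P? : Decidable {A = Fin n} P) (f : Fin n → ℕ) (c : ℕ) →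
             (∀ i → P i → f i ≡ c) → (∀ i → ¬ P i → f i ≡ 0) → ∑[ i < n ] f i ≡ count P? * c
∑-const-on {n = zero} P? f c yes-c no-0 = refl
∑-const-on {n = suc n} P? f c yes-c no-0 = begin
  f zero + sum (f ∘ suc)             ≡⟨ cong₂ _+_ (head (P? zero)) (∑-const-on (P? ∘ suc) (f ∘ suc) c (yes-c ∘ suc) (no-0 ∘ suc)) ⟩
  ⟦ P? zero ⟧ * c + count (P? ∘ suc) * c ≡⟨ *-distribʳ-+ c ⟦ P? zero ⟧ _ ⟨
  count P? * c ∎
  where
  open ≡-Reasoning
  head : (d : Dec _) → f zero ≡ ⟦ d ⟧ * c
  head (yes P0) = trans (yes-c zero P0) (sym (+-identityʳ c))
  head (no ¬P0) = no-0 zero ¬P0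

-- Sum the incidence matrix of R by rows and by columns; rows outside P and columns outside Q are
-- empty.
double-count : ∀ {R : Fin m → Fin n → Set} (R? : ∀ i j → Dec (R i j))
  {P : Pred (Fin m) 0ℓ} (P? : Decidable P) (c : ℕ) {Q : Pred (Fin n) 0ℓ} (Q? : Decidable Q) (d : ℕ) →
  (∀ i → P i → count (R? i) ≡ c) → (∀ i j → R i j → P i) →
  (∀ j → Q j → count (λ i → R? i j) ≡ d) → (∀ i j → R i j → Q j) →
  count P? * c ≡ count Q? * d
double-count {m} {n} R? P? c Q? d onP inP onQ inQ = begin
  count P? * c                        ≡⟨ ∑-const-on P? _ c onP (λ i ¬Pi → count-none (R? i) λ j Rij → ¬Pi (inP i j Rij)) ⟨
  ∑[ i < m ] ∑[ j < n ] ⟦ R? i j ⟧    ≡⟨ ∑-comm (λ i j → ⟦ R? i j ⟧) ⟩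
  ∑[ j < n ] ∑[ i < m ] ⟦ R? i j ⟧    ≡⟨ ∑-const-on Q? _ d onQ (λ j ¬Qj → count-none (λ i → R? i j) λ i Rij → ¬Qj (inQ i j Rij)) ⟩
  count Q? * d                        ∎
  where open ≡-Reasoning

-- P is a union of classes. Removing the class of one element leaves a smaller union of classes, so
-- induction on the size of P applies.
∣-count-classes : ∀ {_~_ : Fin n → Fin n → Set} (_~?_ : ∀ x y → Dec (x ~ y)) →
  (∀ x → x ~ x) → (∀ {x y} → x ~ y → y ~ x) → (∀ {x y z} → x ~ y → y ~ z → x ~ z) →
  ∀ d {P : Pred (Fin n) 0ℓ} (P? : Decidable P) → (∀ {x y} → x ~ y → P x → P y) →
  (∀ x → P x → d ∣ count (x ~?_)) → d ∣ count P?
∣-count-classes {n} {_~_} _~?_ rfl sy tr d P? = go P? (<-wellFounded _)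
  where
  go : ∀ {P : Pred (Fin n) 0ℓ} (P? : Decidable P) → Acc _<_ (count P?) → (∀ {x y} → x ~ y → P x → P y) →
       (∀ x → P x → d ∣ count (x ~?_)) → d ∣ count P?
  go {P} P? (acc rs) closed d∣class with any? P?
  ... | no ¬∃ = subst (d ∣_) (sym (count-none P? λ i Pi → ¬∃ (i , Pi))) (d ∣0)
  ... | yes (x , Px) = subst (d ∣_) (sym split) (∣m∣n⇒∣m+n (d∣class x Px)
          (go rest? (rs smaller) (λ y~z (Py , x≁y) → closed y~z Py , λ x~z → x≁y (tr x~z (sy y~z)))
              (λ y → d∣class y ∘ proj₁)))
    where
    rest? : Decidable (λ y → P y × ¬ x ~ y)
    rest? y = P? y ×-dec ¬? (x ~? y)
    split = count-remove (x ~?_) P? (λ y x~y → closed x~y Px)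
    smaller : count rest? < count P?
    smaller = count-strict rest? P? (λ _ → proj₁) x Px (λ (_ , x≁x) → x≁x (rfl x))

-- Finite groups: powers and conjugation

finGroup⇒group : FinGroup → Group 0ℓ 0ℓ
finGroup⇒group G = record
  { isGroup = record
    { isMonoid = record
      { isSemigroup = record
        { isMagma = record { isEquivalence = isEquivalence ; ∙-cong = cong₂ _·_ }
        ; assoc = assoc }
      ; identity = idˡ , idʳ }
    ; inverse = invˡ , invʳ
    ; ⁻¹-cong = cong inv } }
  where open FinGroup G

module FiniteGroup (G : FinGroup) where
  open FinGroup G
  open import Algebra.Properties.Group (finGroup⇒group G)
    using (\\-leftDividesˡ; \\-leftDividesʳ; inverseʳ-unique; ⁻¹-involutive; ⁻¹-anti-homo-∙; ε⁻¹≈ε; ∙-cancelˡ)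
  open ≡-Reasoning

  infixr 25 _↑_
  _↑_ : Elt G → ℕ → Elt G
  x ↑ k = pow G x k

  ↑-+ : ∀ x m n → x ↑ (m + n) ≡ x ↑ m · x ↑ n
  ↑-+ x zero n = sym (idˡ _)
  ↑-+ x (suc m) n = trans (cong (x ·_) (↑-+ x m n)) (sym (assoc _ _ _))

  ↑-* : ∀ x m n → x ↑ (m * n) ≡ (x ↑ n) ↑ m
  ↑-* x zero n = refl
  ↑-* x (suc m) n = trans (↑-+ x n (m * n)) (cong (x ↑ n ·_) (↑-* x m n))

  ↑-comm : ∀ x m n → (x ↑ m) ↑ n ≡ (x ↑ n) ↑ m
  ↑-comm x m n = trans (sym (↑-* x n m)) (trans (cong (x ↑_) (*-comm n m)) (↑-* x m n))

  e↑ : ∀ k → e ↑ k ≡ e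
  e↑ zero = refl
  e↑ (suc k) = trans (idˡ _) (e↑ k)

  ↑-1 : ∀ x → x ↑ 1 ≡ x
  ↑-1 = idʳ

  conj : Elt G → Elt G → Elt G
  conj g x = (g · x) · inv g

  conj-· : ∀ g x y → conj g (x · y) ≡ conj g x · conj g y
  conj-· g x y = begin
    (g · (x · y)) · inv g                     ≡⟨ assoc _ _ _ ⟩
    g · ((x · y) · inv g)                     ≡⟨ cong (g ·_) (assoc _ _ _) ⟩
    g · (x · (y · inv g))                     ≡⟨ cong (λ t → g · (x · t)) (\\-leftDividesʳ g _) ⟨
    g · (x · (inv g · (g · (y · inv g))))     ≡⟨ cong (λ t → g · (x · (inv g · t))) (assoc _ _ _) ⟨
    g · (x · (inv g · conj g y))              ≡⟨ assoc _ _ _ ⟨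
    (g · x) · (inv g · conj g y)              ≡⟨ assoc _ _ _ ⟨
    conj g x · conj g y                       ∎

  conj-e : ∀ g → conj g e ≡ e
  conj-e g = trans (cong (_· inv g) (idʳ g)) (invʳ g)

  conj-↑ : ∀ g x k → conj g (x ↑ k) ≡ conj g x ↑ k
  conj-↑ g x zero = conj-e g
  conj-↑ g x (suc k) = trans (conj-· g x (x ↑ k)) (cong (conj g x ·_) (conj-↑ g x k))

  conj-conj : ∀ g h x → conj g (conj h x) ≡ conj (g · h) x
  conj-conj g h x = begin
    (g · ((h · x) · inv h)) · inv g   ≡⟨ cong (_· inv g) (assoc _ _ _) ⟨
    ((g · (h · x)) · inv h) · inv g   ≡⟨ assoc _ _ _ ⟩
    (g · (h · x)) · (inv h · inv g)   ≡⟨ cong₂ _·_ (assoc _ _ _) (⁻¹-anti-homo-∙ g h) ⟨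
    conj (g · h) x                    ∎

  e-conj : ∀ x → conj e x ≡ x
  e-conj x = trans (cong₂ _·_ (idˡ x) ε⁻¹≈ε) (idʳ x)

  conj-inverseˡ : ∀ g x → conj (inv g) (conj g x) ≡ x
  conj-inverseˡ g x = trans (conj-conj (inv g) g x) (trans (cong (λ t → conj t x) (invˡ g)) (e-conj x))

  -- Orders and cyclic subgroups

  -- Among the first size + 1 powers two coincide, and cancelling gives a positive exponent that
  -- kills x; `least` descends to the smallest one.
  order : ∀ x → ∃ (IsOrder G x)
  order x with pigeonhole (n<1+n size) (λ i → x ↑ toℕ i)
  ... | i , j , i<j , xⁱ≡xʲ = least (toℕ j ∸ toℕ i) (<-wellFounded _) (m<n⇒0<n∸m i<j)
          (∙-cancelˡ (x ↑ toℕ i) _ _ (begin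
            x ↑ toℕ i · x ↑ (toℕ j ∸ toℕ i)   ≡⟨ ↑-+ x (toℕ i) _ ⟨
            x ↑ (toℕ i + (toℕ j ∸ toℕ i))     ≡⟨ cong (x ↑_) (m+[n∸m]≡n (<⇒≤ i<j)) ⟩
            x ↑ toℕ j                         ≡⟨ xⁱ≡xʲ ⟨
            x ↑ toℕ i                         ≡⟨ idʳ _ ⟨
            x ↑ toℕ i · e                     ∎))
    where
    least : ∀ m → Acc _<_ m → 1 ≤ m → x ↑ m ≡ e → ∃ (IsOrder G x)
    least m (acc rs) 1≤m xᵐ≡e with anyUpTo? (λ k → (1 ≤? k) ×-dec (x ↑ k ≟ e)) m
    ... | yes (k , k<m , 1≤k , xᵏ≡e) = least k (rs k<m) 1≤k xᵏ≡e
    ... | no ¬smaller = m , 1≤m , xᵐ≡e , λ j 1≤j j<m xʲ≡e → ¬smaller (j , j<m , 1≤j , xʲ≡e)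

  ↑-%-order : ∀ {x m} .{{_ : NonZero m}} → IsOrder G x m → ∀ k → x ↑ k ≡ x ↑ (k % m)
  ↑-%-order {x} {m} (_ , xᵐ≡e , _) k = begin
    x ↑ k                             ≡⟨ cong (x ↑_) (m≡m%n+[m/n]*n k m) ⟩
    x ↑ (k % m + k / m * m)           ≡⟨ ↑-+ x (k % m) _ ⟩
    x ↑ (k % m) · x ↑ (k / m * m)     ≡⟨ cong (x ↑ (k % m) ·_) (↑-* x (k / m) m) ⟩
    x ↑ (k % m) · (x ↑ m) ↑ (k / m)   ≡⟨ cong (λ t → x ↑ (k % m) · t ↑ (k / m)) xᵐ≡e ⟩
    x ↑ (k % m) · e ↑ (k / m)         ≡⟨ cong (x ↑ (k % m) ·_) (e↑ (k / m)) ⟩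
    x ↑ (k % m) · e                   ≡⟨ idʳ _ ⟩
    x ↑ (k % m)                       ∎

  ↑-injective-≤ : ∀ {x m i j} → IsOrder G x m → i ≤ j → j < m → x ↑ i ≡ x ↑ j → i ≡ j
  ↑-injective-≤ {x} {m} {i} {j} (_ , _ , minimal) i≤j j<m xⁱ≡xʲ with j ∸ i in eq
  ... | zero  = ≤-antisym i≤j (m∸n≡0⇒m≤n eq)
  ... | suc d = contradiction (∙-cancelˡ (x ↑ i) _ _ (begin
      x ↑ i · x ↑ suc d   ≡⟨ ↑-+ x i (suc d) ⟨
      x ↑ (i + suc d)     ≡⟨ cong (λ t → x ↑ (i + t)) eq ⟨
      x ↑ (i + (j ∸ i))   ≡⟨ cong (x ↑_) (m+[n∸m]≡n i≤j) ⟩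
      x ↑ j               ≡⟨ xⁱ≡xʲ ⟨
      x ↑ i               ≡⟨ idʳ _ ⟨
      x ↑ i · e           ∎)) (minimal (suc d) (s≤s z≤n) (≤-<-trans (subst (_≤ j) eq (m∸n≤m j i)) j<m))

  ↑-injective : ∀ {x m i j} → IsOrder G x m → i < m → j < m → x ↑ i ≡ x ↑ j → i ≡ j
  ↑-injective {i = i} {j} ord i<m j<m eq with ≤-total i j
  ... | inj₁ i≤j = ↑-injective-≤ ord i≤j j<m eq
  ... | inj₂ j≤i = sym (↑-injective-≤ ord j≤i i<m (sym eq))

  -- Exponents reduce modulo the order of x, so the unbounded existential becomes a finite search.
  inCyclic? : ∀ x h → Dec (InCyclic G x h)
  inCyclic? x h with order x
  ... | m@(suc _) , ord = map′ (λ (i , eq) → toℕ i , eq)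
    (λ (k , eq) → fromℕ< (m%n<n k m) ,
       trans eq (trans (↑-%-order ord k) (cong (x ↑_) (sym (toℕ-fromℕ< (m%n<n k m))))))
    (any? λ (i : Fin m) → h ≟ x ↑ toℕ i)

  inCyclic-refl : ∀ x → InCyclic G x x
  inCyclic-refl x = 1 , sym (↑-1 x)

  inCyclic-· : ∀ {x y z} → InCyclic G x y → InCyclic G x z → InCyclic G x (y · z)
  inCyclic-· {x} (i , refl) (j , refl) = i + j , sym (↑-+ x i j)

  -- Subgroups, Lagrange's theorem and normalizers

  infix 4 _∈_ _∉_ _∈?_ _⊆_
  _∈_ _∉_ : Elt G → Subgroup G → Set
  x ∈ K = T (Subgroup.mem K x)
  x ∉ K = ¬ x ∈ K

  _∈?_ : ∀ x K → Dec (x ∈ K)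
  x ∈? K = T? (Subgroup.mem K x)

  _⊆_ : Subgroup G → Subgroup G → Set
  K ⊆ L = ∀ x → x ∈ K → x ∈ L

  ∣_∣ₛ : Subgroup G → ℕ
  ∣ K ∣ₛ = count (_∈? K)

  module _ (K : Subgroup G) where
    open Subgroup K

    ∈-↑ : ∀ {x} → x ∈ K → ∀ k → x ↑ k ∈ K
    ∈-↑ x∈K zero = has-e
    ∈-↑ x∈K (suc k) = closed _ _ x∈K (∈-↑ x∈K k)

    ∈-inv⁻¹ : ∀ {x} → inv x ∈ K → x ∈ K
    ∈-inv⁻¹ {x} x⁻¹∈K = subst (_∈ K) (⁻¹-involutive x) (inv-cl _ x⁻¹∈K)

    ∈-cancelˡ : ∀ {x y} → x ∈ K → x · y ∈ K → y ∈ K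
    ∈-cancelˡ {x} {y} x∈K xy∈K = subst (_∈ K) (\\-leftDividesʳ x y) (closed _ _ (inv-cl _ x∈K) xy∈K)

    ∈-cancelʳ : ∀ {x y} → y ∈ K → x · y ∈ K → x ∈ K
    ∈-cancelʳ {x} {y} y∈K xy∈K =
      subst (_∈ K) (trans (assoc _ _ _) (trans (cong (x ·_) (invʳ y)) (idʳ x))) (closed _ _ xy∈K (inv-cl _ y∈K))

  -- In a finite group inverses are powers, so closure under products suffices.
  closed⇒subgroup : {P : Pred (Elt G) 0ℓ} → Decidable P → P e →
                    (∀ {x y} → P x → P y → P (x · y)) → Subgroup G
  closed⇒subgroup {P} P? Pe P· = record
    { mem = λ x → ⌊ P? x ⌋
    ; has-e = fromWitness Pe
    ; closed = λ x y Px Py → fromWitness (P· (toWitness Px) (toWitness Py))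
    ; inv-cl = λ x Px → fromWitness (P-inv x (toWitness Px)) }
    where
    P-↑ : ∀ {x} → P x → ∀ k → P (x ↑ k)
    P-↑ Px zero = Pe
    P-↑ Px (suc k) = P· Px (P-↑ Px k)
    P-inv : ∀ x → P x → P (inv x)
    P-inv x Px with order x
    ... | suc m , _ , xᵐ⁺¹≡e , _ = subst P (inverseʳ-unique x _ xᵐ⁺¹≡e) (P-↑ Px m)

  whole : Subgroup G
  whole = closed⇒subgroup (λ _ → yes tt) tt _

  ∣whole∣ : ∣ whole ∣ₛ ≡ size
  ∣whole∣ = count-all (_∈? whole) _

  cyclic : Elt G → Subgroup G
  cyclic x = closed⇒subgroup (inCyclic? x) (0 , refl) inCyclic-·

  -- The classes are the left cosets x K, each carried onto K by left translation; L is a union of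
  -- them.
  lagrange : ∀ K L → K ⊆ L → ∣ K ∣ₛ ∣ ∣ L ∣ₛ
  lagrange K L K⊆L =
    ∣-count-classes _~?_ ~-refl ~-sym ~-trans ∣ K ∣ₛ (_∈? L)
      (λ {x} {y} x~y x∈L → subst (_∈ L) (\\-leftDividesˡ x y) (closed L _ _ x∈L (K⊆L _ x~y)))
      (λ x _ → ∣-reflexive (sym (count-bijection (_∈? K) (inv x ·_) (x ·_) (\\-leftDividesʳ x) (\\-leftDividesˡ x))))
    where
    open Subgroup
    _~_ : Elt G → Elt G → Set
    x ~ y = inv x · y ∈ K
    _~?_ : ∀ x y → Dec (x ~ y)
    x ~? y = inv x · y ∈? K
    ~-refl : ∀ x → x ~ x
    ~-refl x = subst (_∈ K) (sym (invˡ x)) (has-e K)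
    ~-sym : ∀ {x y} → x ~ y → y ~ x
    ~-sym {x} {y} x~y = subst (_∈ K)
      (trans (⁻¹-anti-homo-∙ _ _) (cong (inv y ·_) (⁻¹-involutive x))) (inv-cl K _ x~y)
    ~-trans : ∀ {x y z} → x ~ y → y ~ z → x ~ z
    ~-trans {x} {y} {z} x~y y~z = subst (_∈ K)
      (trans (assoc _ _ _) (cong (inv x ·_) (\\-leftDividesˡ y z))) (closed K _ _ x~y y~z)

  ∣_∣-divides-size : ∀ K → ∣ K ∣ₛ ∣ size
  ∣ K ∣-divides-size = subst (∣ K ∣ₛ ∣_) ∣whole∣ (lagrange K whole _)

  -- Double count of the graph of i ↦ x ^ i for i < m: each exponent gives one element, and each
  -- element of ⟨x⟩ comes from one exponent.
  ∣cyclic∣ : ∀ {x m} → IsOrder G x m → ∣ cyclic x ∣ₛ ≡ m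
  ∣cyclic∣ {x} {m@(suc _)} ord = begin
    ∣ cyclic x ∣ₛ               ≡⟨ *-identityʳ _ ⟨
    ∣ cyclic x ∣ₛ * 1           ≡⟨ double-count (λ i h → h ≟ x ↑ toℕ i) (λ (_ : Fin m) → yes tt) 1 (_∈? cyclic x) 1
        (λ i _ → count-unique (_≟ x ↑ toℕ i) (x ↑ toℕ i) refl (λ _ → id))
        (λ _ _ _ → tt) one (λ i h eq → fromWitness (toℕ i , eq)) ⟨
    count (λ (_ : Fin m) → yes tt) * 1 ≡⟨ *-identityʳ _ ⟩
    count (λ (_ : Fin m) → yes tt) ≡⟨ count-all (λ (_ : Fin m) → yes tt) _ ⟩
    m ∎
    where
    one : ∀ h → h ∈ cyclic x → count (λ (i : Fin m) → h ≟ x ↑ toℕ i) ≡ 1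
    one h h∈ with k , h≡xᵏ ← toWitness {a? = inCyclic? x h} h∈ =
      count-unique (λ i → h ≟ x ↑ toℕ i) (fromℕ< k%m<m) h≡ (λ i eq →
        toℕ-injective (↑-injective ord (toℕ<n i) (toℕ<n _) (trans (sym eq) h≡)))
      where
      k%m<m = m%n<n k m
      h≡ : h ≡ x ↑ toℕ (fromℕ< k%m<m)
      h≡ = trans h≡xᵏ (trans (↑-%-order ord k) (cong (x ↑_) (sym (toℕ-fromℕ< k%m<m))))

  ↑-size : ∀ x → x ↑ size ≡ e
  ↑-size x with order x
  ... | m , ord@(_ , xᵐ≡e , _) with divides q eq ← subst (_∣ size) (∣cyclic∣ ord) ∣ cyclic x ∣-divides-size = begin
    x ↑ size      ≡⟨ cong (x ↑_) eq ⟩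
    x ↑ (q * m)   ≡⟨ ↑-* x q m ⟩
    (x ↑ m) ↑ q   ≡⟨ cong (_↑ q) xᵐ≡e ⟩
    e ↑ q         ≡⟨ e↑ q ⟩
    e             ∎

  -- Lets inverses be absorbed into natural exponents. The element `e` witnesses that size is
  -- positive, so the truncated subtraction is exact.
  inv-↑ : ∀ x → inv x ≡ x ↑ (size ∸ 1)
  inv-↑ x = sym (inverseʳ-unique x _ (trans (cong (x ↑_) (m+[n∸m]≡n (≤-<-trans z≤n (toℕ<n e)))) (↑-size x)))

  -- Only g K g⁻¹ ⊆ K is required; as K is finite, this already forces equality.
  normalizer : Subgroup G → Subgroup G
  normalizer K = closed⇒subgroup (λ g → all? λ k → (k ∈? K) →-dec (conj g k ∈? K))
    (λ k → subst (_∈ K) (sym (e-conj k)))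
    (λ {g} {h} Ng Nh k k∈K → subst (_∈ K) (conj-conj g h k) (Ng _ (Nh k k∈K)))

  ∈-normalizer⁻ : ∀ {K g} → g ∈ normalizer K → ∀ k → k ∈ K → conj g k ∈ K
  ∈-normalizer⁻ {K} {g} = toWitness {a? = all? λ k → (k ∈? K) →-dec (conj g k ∈? K)}

  ∈-normalizer⁺ : ∀ {K g} → (∀ k → k ∈ K → conj g k ∈ K) → g ∈ normalizer K
  ∈-normalizer⁺ {K} {g} = fromWitness {a? = all? λ k → (k ∈? K) →-dec (conj g k ∈? K)}

  ⊆-normalizer : ∀ K → K ⊆ normalizer K
  ⊆-normalizer K g g∈K = ∈-normalizer⁺ {K} λ k k∈K → closed _ _ (closed _ _ g∈K k∈K) (inv-cl _ g∈K)
    where open Subgroup K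

sum-tabulate : ∀ {n} (f : Fin n → ℕ) → sumₗ (tabulate f) ≡ ∑[ i < n ] f i
sum-tabulate {zero} f = refl
sum-tabulate {suc n} f = cong (f zero +_) (sum-tabulate (f ∘ suc))

-- Finite p-groups

module PGroup {p} (pp : Prime p) (G : FinGroup) (r : ℕ) (size≡pʳ : FinGroup.size G ≡ p ^ r) where
  open FinGroup G
  open FiniteGroup G
  open import Algebra.Properties.Group (finGroup⇒group G)
    using (\\-leftDividesˡ; \\-leftDividesʳ; ⁻¹-involutive; ⁻¹-anti-homo-∙; ε⁻¹≈ε)
  open ≡-Reasoning
  open Subgroup

  ∣∣-nonZero : ∀ {K} → NonZero ∣ K ∣ₛ
  ∣∣-nonZero {K} = >-nonZero (count-pos (_∈? K) e (has-e K))

  -- Growth of normalizers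

  module DoubleCosets (K : Subgroup G) where

    -- inv x · (inv k · y) ∈ K says that y ∈ k x K
    _~_ : Elt G → Elt G → Set
    x ~ y = ∃ λ k → k ∈ K × inv x · (inv k · y) ∈ K

    _~?_ : ∀ x y → Dec (x ~ y)
    x ~? y = any? λ k → (k ∈? K) ×-dec (inv x · (inv k · y) ∈? K)

    ~-refl : ∀ x → x ~ x
    ~-refl x = e , has-e K , subst (_∈ K)
      (sym (trans (cong (inv x ·_) (trans (cong (_· x) ε⁻¹≈ε) (idˡ x))) (invˡ x))) (has-e K)

    ~-sym : ∀ {x y} → x ~ y → y ~ x
    ~-sym {x} {y} (k , k∈K , c∈K) = inv k , inv-cl K _ k∈K , subst (_∈ K) eq (inv-cl K _ c∈K)
      where
      eq : inv (inv x · (inv k · y)) ≡ inv y · (inv (inv k) · x)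
      eq = begin
        inv (inv x · (inv k · y))             ≡⟨ ⁻¹-anti-homo-∙ _ _ ⟩
        inv (inv k · y) · inv (inv x)         ≡⟨ cong₂ _·_ (⁻¹-anti-homo-∙ _ _) (⁻¹-involutive x) ⟩
        (inv y · inv (inv k)) · x             ≡⟨ assoc _ _ _ ⟩
        inv y · (inv (inv k) · x)             ∎

    ~-trans : ∀ {x y z} → x ~ y → y ~ z → x ~ z
    ~-trans {x} {y} {z} (k , k∈K , c∈K) (l , l∈K , d∈K) =
      l · k , closed K _ _ l∈K k∈K , subst (_∈ K) eq (closed K _ _ c∈K d∈K)
      where
      eq : (inv x · (inv k · y)) · (inv y · (inv l · z)) ≡ inv x · (inv (l · k) · z)
      eq = begin
        (inv x · (inv k · y)) · (inv y · (inv l · z))   ≡⟨ assoc _ _ _ ⟩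
        inv x · ((inv k · y) · (inv y · (inv l · z)))   ≡⟨ cong (inv x ·_) (assoc _ _ _) ⟩
        inv x · (inv k · (y · (inv y · (inv l · z))))   ≡⟨ cong (λ t → inv x · (inv k · t)) (\\-leftDividesˡ y _) ⟩
        inv x · (inv k · (inv l · z))                   ≡⟨ cong (inv x ·_) (assoc _ _ _) ⟨
        inv x · ((inv k · inv l) · z)                   ≡⟨ cong (λ t → inv x · (t · z)) (⁻¹-anti-homo-∙ l k) ⟨
        inv x · (inv (l · k) · z)                       ∎

    -- This is K ∩ x K x⁻¹, the stabilizer of the coset x K when K acts by left multiplication.
    stabilizer : Elt G → Subgroup G
    stabilizer x = closed⇒subgroup (λ k → (k ∈? K) ×-dec (conj (inv x) k ∈? K))
      (has-e K , subst (_∈ K) (sym (conj-e _)) (has-e K))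
      (λ (k∈K , kˣ∈K) (l∈K , lˣ∈K) → closed K _ _ k∈K l∈K ,
         subst (_∈ K) (sym (conj-· _ _ _)) (closed K _ _ kˣ∈K lˣ∈K))

    ∈-stabilizer⁻ : ∀ {x k} → k ∈ stabilizer x → k ∈ K × conj (inv x) k ∈ K
    ∈-stabilizer⁻ {x} {k} = toWitness {a? = (k ∈? K) ×-dec (conj (inv x) k ∈? K)}

    ∈-stabilizer⁺ : ∀ {x k} → k ∈ K × conj (inv x) k ∈ K → k ∈ stabilizer x
    ∈-stabilizer⁺ {x} {k} = fromWitness {a? = (k ∈? K) ×-dec (conj (inv x) k ∈? K)}

    -- Count pairs (k, h) with k in K and h in k x K. Each k admits ∣K∣ values of h; for each h in K
    -- x K the admissible k form a left coset of the stabilizer.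
    ∣K∣²≡ : ∀ x → ∣ K ∣ₛ * ∣ K ∣ₛ ≡ count (x ~?_) * ∣ stabilizer x ∣ₛ
    ∣K∣²≡ x = double-count R? (_∈? K) ∣ K ∣ₛ (x ~?_) ∣ stabilizer x ∣ₛ
      onK (λ _ _ → proj₁) onClass (λ k _ Rkh → k , Rkh)
      where
      R : Elt G → Elt G → Set
      R k h = k ∈ K × inv x · (inv k · h) ∈ K
      R? : ∀ k h → Dec (R k h)
      R? k h = (k ∈? K) ×-dec (inv x · (inv k · h) ∈? K)
      onK : ∀ k → k ∈ K → count (R? k) ≡ ∣ K ∣ₛ
      onK k k∈K = trans
        (count-cong (R? k) (λ h → inv x · (inv k · h) ∈? K) (λ _ → proj₂) (λ _ → k∈K ,_))
        (count-bijection (_∈? K) (λ h → inv x · (inv k · h)) (λ h → k · (x · h))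
          (λ h → trans (cong (inv x ·_) (\\-leftDividesʳ k _)) (\\-leftDividesʳ x h))
          (λ h → trans (cong (k ·_) (\\-leftDividesˡ x _)) (\\-leftDividesˡ k h)))
      onClass : ∀ h → x ~ h → count (λ k → R? k h) ≡ ∣ stabilizer x ∣ₛ
      onClass h (k₀ , k₀∈K , c∈K) = trans
        (count-cong (λ k → R? k h) (λ k → inv k₀ · k ∈? stabilizer x) to from)
        (count-bijection (_∈? stabilizer x) (inv k₀ ·_) (k₀ ·_) (\\-leftDividesʳ k₀) (\\-leftDividesˡ k₀))
        where
        -- When the right-hand side lies in K, one factor on the left lies in K exactly when the
        -- other does; `to` and `from` use the two directions.
        shift : ∀ k → conj (inv x) (inv k₀ · k) · (inv x · (inv k · h)) ≡ inv x · (inv k₀ · h)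
        shift k = begin
          ((inv x · (inv k₀ · k)) · inv (inv x)) · (inv x · (inv k · h))  ≡⟨ assoc _ _ _ ⟩
          (inv x · (inv k₀ · k)) · (inv (inv x) · (inv x · (inv k · h)))  ≡⟨ cong ((inv x · (inv k₀ · k)) ·_) (\\-leftDividesʳ (inv x) _) ⟩
          (inv x · (inv k₀ · k)) · (inv k · h)                            ≡⟨ assoc _ _ _ ⟩
          inv x · ((inv k₀ · k) · (inv k · h))                            ≡⟨ cong (inv x ·_) (assoc _ _ _) ⟩
          inv x · (inv k₀ · (k · (inv k · h)))                            ≡⟨ cong (λ t → inv x · (inv k₀ · t)) (\\-leftDividesˡ k h) ⟩
          inv x · (inv k₀ · h)                                            ∎
        to : ∀ k → R k h → inv k₀ · k ∈ stabilizer x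
        to k (k∈K , d∈K) = ∈-stabilizer⁺ (closed K _ _ (inv-cl K _ k₀∈K) k∈K ,
          ∈-cancelʳ K d∈K (subst (_∈ K) (sym (shift k)) c∈K))
        from : ∀ k → inv k₀ · k ∈ stabilizer x → R k h
        from k l∈S with l∈K , lˣ∈K ← ∈-stabilizer⁻ l∈S =
          ∈-cancelˡ K (inv-cl K _ k₀∈K) l∈K ,
          ∈-cancelˡ K lˣ∈K (subst (_∈ K) (sym (shift k)) c∈K)

  module _ (K : Subgroup G) where
    open DoubleCosets K

    private
      ∣∣-divides-pʳ : ∣ K ∣ₛ ∣ p ^ r
      ∣∣-divides-pʳ = subst (∣ K ∣ₛ ∣_) size≡pʳ ∣ K ∣-divides-size

    -- A double coset K x K is a single left coset only if x normalizes K.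
    p∣K∣∣double-coset : ∀ x → inv x ∉ normalizer K → p * ∣ K ∣ₛ ∣ count (x ~?_)
    p∣K∣∣double-coset x x⁻¹∉N =
      rescale (prime*properDivisor-∣ pp r ∣∣-divides-pʳ
        (lagrange (stabilizer x) K (λ _ → proj₁ ∘ ∈-stabilizer⁻)) smaller)
      where
      S = ∣ stabilizer x ∣ₛ
      smaller : S ≢ ∣ K ∣ₛ
      smaller S≡K = x⁻¹∉N (∈-normalizer⁺ {K} λ k k∈K → decidable-stable (conj (inv x) k ∈? K) λ kˣ∉K →
        <⇒≢ (count-strict (_∈? stabilizer x) (_∈? K) (λ _ → proj₁ ∘ ∈-stabilizer⁻) k k∈K
              (kˣ∉K ∘ proj₂ ∘ ∈-stabilizer⁻)) S≡K)
      -- By `∣K∣²≡` the double coset has ∣K∣ · (∣K∣ / S) elements, and p divides the second factor.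
      rescale : p * S ∣ ∣ K ∣ₛ → p * ∣ K ∣ₛ ∣ count (x ~?_)
      rescale (divides q eq) = divides q (*-cancelʳ-≡ _ _ S {{∣∣-nonZero {stabilizer x}}} (begin
        count (x ~?_) * S       ≡⟨ ∣K∣²≡ x ⟨
        ∣ K ∣ₛ * ∣ K ∣ₛ         ≡⟨ cong (_* ∣ K ∣ₛ) eq ⟩
        q * (p * S) * ∣ K ∣ₛ    ≡⟨ regroup q p S ∣ K ∣ₛ ⟩
        q * (p * ∣ K ∣ₛ) * S    ∎))
        where
        regroup : ∀ q p s k → q * (p * s) * k ≡ q * (p * k) * s
        regroup = solve-∀

    self-normalizing⇒whole : normalizer K ⊆ K → ∀ x → x ∈ K
    self-normalizing⇒whole N⊆K x = decidable-stable (x ∈? K) λ x∉K →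
      let K<size : ∣ K ∣ₛ < size
          K<size = subst (∣ K ∣ₛ <_) ∣whole∣ (count-strict (_∈? K) (_∈? whole) _ x _ x∉K)
          p∣K∣∣size = subst (p * ∣ K ∣ₛ ∣_) (sym size≡pʳ)
            (prime*properDivisor-∣ pp r ∣-refl ∣∣-divides-pʳ (<⇒≢ (subst (∣ K ∣ₛ <_) size≡pʳ K<size)))
          p∣K∣∣∣K∣ = ∣m+n∣m⇒∣n (subst (p * ∣ K ∣ₛ ∣_) size-split p∣K∣∣size) p∣K∣∣∁K
      in <⇒≱ (m<m*n ∣ K ∣ₛ p {{∣∣-nonZero {K}}} (nonTrivial⇒n>1 p))
          (subst (_≤ ∣ K ∣ₛ) (*-comm p ∣ K ∣ₛ) (∣⇒≤ {{∣∣-nonZero {K}}} p∣K∣∣∣K∣))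
      where
      instance _ = prime⇒nonTrivial pp
      size-split : size ≡ count (λ y → (y ∈? whole) ×-dec ¬? (y ∈? K)) + ∣ K ∣ₛ
      size-split = trans (sym ∣whole∣) (trans (count-remove (_∈? K) (_∈? whole) _) (+-comm ∣ K ∣ₛ _))
      -- The complement of K is a union of double cosets: if k is in K and z in k y K were in K,
      -- then y would be too.
      p∣K∣∣∁K : p * ∣ K ∣ₛ ∣ count (λ y → (y ∈? whole) ×-dec ¬? (y ∈? K))
      p∣K∣∣∁K = ∣-count-classes _~?_ ~-refl ~-sym ~-trans (p * ∣ K ∣ₛ) (λ y → (y ∈? whole) ×-dec ¬? (y ∈? K))
        (λ { (k , k∈K , c∈K) (_ , y∉K) → _ , λ z∈K → y∉K (∈-inv⁻¹ K (∈-cancelʳ K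
               (closed K _ _ (inv-cl K _ k∈K) z∈K) c∈K)) })
        (λ y (_ , y∉K) → p∣K∣∣double-coset y λ y⁻¹∈N → y∉K (∈-inv⁻¹ K (N⊆K _ y⁻¹∈N)))

  -- Roots

  ↑-1+pʳ* : ∀ x v → x ↑ (1 + p ^ r * v) ≡ x
  ↑-1+pʳ* x v = begin
    x · x ↑ (p ^ r * v)  ≡⟨ cong (λ t → x · x ↑ (t * v)) size≡pʳ ⟨
    x · x ↑ (size * v)           ≡⟨ cong (λ t → x · x ↑ t) (*-comm size v) ⟩
    x · x ↑ (v * size)           ≡⟨ cong (x ·_) (↑-* x v size) ⟩
    x · (x ↑ size) ↑ v           ≡⟨ cong (λ t → x · t ↑ v) (↑-size x) ⟩
    x · e ↑ v                    ≡⟨ cong (x ·_) (e↑ v) ⟩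
    x · e                        ≡⟨ idʳ x ⟩
    x                            ∎

  -- l is invertible modulo p ^ r, and p ^ r kills every element, so one exponent u undoes the l-th
  -- power map on the whole group.
  ↑-inverse : ∀ {l} → ¬ p ∣ l → ∃ λ u → ∀ x → (x ↑ l) ↑ u ≡ x
  ↑-inverse {l} p∤l with u , v , eq ← inverse-mod-^ pp p∤l r = u , λ x → begin
    (x ↑ l) ↑ u                   ≡⟨ ↑-* x u l ⟨
    x ↑ (u * l)                   ≡⟨ cong (x ↑_) (trans (*-comm u l) eq) ⟩
    x ↑ (1 + p ^ r * v)   ≡⟨ ↑-1+pʳ* x v ⟩
    x                             ∎

  root? : ∀ H l c g → Dec (g ∈ H × g ↑ l ≡ c)
  root? H l c g = (g ∈? H) ×-dec (g ↑ l ≟ c)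

  roots≡count : ∀ H l c → roots G H l c ≡ count (root? H l c)
  roots≡count H l c = trans (cong sumₗ (map-tabulate id (λ g → ⟦ root? H l c g ⟧))) (sum-tabulate (λ g → ⟦ root? H l c g ⟧))

  -- The only candidate `c ↑ u` is a power of c, hence stays inside H.
  roots-unique : ∀ H {l c} → ¬ p ∣ l → c ∈ H → roots G H l c ≡ 1
  roots-unique H {l} {c} p∤l c∈H with u , inverse ← ↑-inverse p∤l =
    trans (roots≡count H l c) (count-unique (root? H l c) (c ↑ u)
      (∈-↑ H c∈H u , trans (↑-comm c u l) (inverse c))
      (λ g (_ , gˡ≡c) → trans (sym (inverse g)) (cong (_↑ u) gˡ≡c)))

  -- Used contrapositively: a conjugate of x ^ p outside ⟨x ^ p⟩ is also outside ⟨x⟩. The cases are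
  -- whether p divides the exponent i of the conjugate.
  conj-of-pth-power : ∀ x g → InCyclic G x (conj g (x ↑ p)) → InCyclic G (x ↑ p) (conj g (x ↑ p))
  conj-of-pth-power x g (i , a≡xⁱ) with p ∣? i
  ... | yes (divides q refl) = q , trans a≡xⁱ (↑-* x q p)
  -- The exponent 0 serves because b, and with it its conjugate, turns out to be `e`.
  ... | no p∤i with u , inverse ← ↑-inverse p∤i = 0 , (begin
      conj g b  ≡⟨ cong (conj g) (trivial r (trans (cong (b ↑_) (sym size≡pʳ)) (↑-size b))) ⟩
      conj g e  ≡⟨ conj-e g ⟩
      e         ∎)
    where
    b = x ↑ p
    a = conj g b
    b≡ : b ≡ (a ↑ p) ↑ u
    b≡ = begin
      x ↑ p               ≡⟨ cong (_↑ p) (inverse x) ⟨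
      ((x ↑ i) ↑ u) ↑ p   ≡⟨ cong (λ t → (t ↑ u) ↑ p) a≡xⁱ ⟨
      (a ↑ u) ↑ p         ≡⟨ ↑-comm a u p ⟩
      (a ↑ p) ↑ u         ∎
    -- b is a power of aᵖ, and bᵖ has smaller order unless b = e.
    trivial : ∀ t → b ↑ (p ^ t) ≡ e → b ≡ e
    trivial zero b¹≡e = trans (sym (↑-1 b)) b¹≡e
    trivial (suc t) eq = trivial t (begin
      b ↑ (p ^ t)                ≡⟨ cong (_↑ (p ^ t)) b≡ ⟩
      ((a ↑ p) ↑ u) ↑ (p ^ t)    ≡⟨ ↑-comm (a ↑ p) u (p ^ t) ⟩
      ((a ↑ p) ↑ (p ^ t)) ↑ u    ≡⟨ cong (_↑ u) (begin
          (a ↑ p) ↑ (p ^ t)      ≡⟨ ↑-comm a p (p ^ t) ⟩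
          (a ↑ (p ^ t)) ↑ p      ≡⟨ ↑-* a p (p ^ t) ⟨
          a ↑ (p ^ suc t)        ≡⟨ conj-↑ g b (p ^ suc t) ⟨
          conj g (b ↑ (p ^ suc t)) ≡⟨ cong (conj g) eq ⟩
          conj g e               ≡⟨ conj-e g ⟩
          e                      ∎) ⟩
      e ↑ u                      ≡⟨ e↑ u ⟩
      e                          ∎)

  -- Normalizers are iterated until just before a enters. Here `fuel` bounds the number of elements
  -- outside the current subgroup, and every step enlarges that subgroup strictly.
  normalizing-extension : ∀ K {a} → a ∉ K → ∃ λ L → K ⊆ L × a ∉ L × a ∈ normalizer L
  normalizing-extension K {a} = go size K (m≤m+n _ _)
    where
    go : ∀ fuel K → size ≤ fuel + ∣ K ∣ₛ → a ∉ K → ∃ λ L → K ⊆ L × a ∉ L × a ∈ normalizer L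
    go zero K size≤ a∉K = contradiction size≤
      (<⇒≱ (subst (∣ K ∣ₛ <_) ∣whole∣ (count-strict (_∈? K) (_∈? whole) _ a _ a∉K)))
    go (suc fuel) K size≤ a∉K with a ∈? normalizer K
    ... | yes a∈N = K , (λ _ → id) , a∉K , a∈N
    ... | no a∉N with any? (λ x → (x ∈? normalizer K) ×-dec ¬? (x ∈? K))
    ... | no N⊆K = contradiction (self-normalizing⇒whole K (λ x x∈N →
        decidable-stable (x ∈? K) λ x∉K → N⊆K (x , x∈N , x∉K)) a) a∉K
    ... | yes (x , x∈N , x∉K) with L , N⊆L , a∉L , a∈NL ← go fuel (normalizer K)
        (≤-trans size≤ (≤-trans (≤-reflexive (sym (+-suc fuel _)))
          (+-monoʳ-≤ fuel (count-strict (_∈? K) (_∈? normalizer K) (⊆-normalizer K) x x∈N x∉K)))) a∉N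
      = L , (λ y y∈K → N⊆L y (⊆-normalizer K y y∈K)) , a∉L , a∈NL

  -- The subgroup K⟨a⟩

  module Extension (K : Subgroup G) (a : Elt G) (a∈N : a ∈ normalizer K) where

    -- Membership in the set product K⟨a⟩: c is the ⟨a⟩-factor of h, and h c⁻¹ the K-factor.
    InProduct : Elt G → Set
    InProduct h = ∃ λ c → InCyclic G a c × h · inv c ∈ K

    inProduct? : ∀ h → Dec (InProduct h)
    inProduct? h = any? λ c → inCyclic? a c ×-dec (h · inv c ∈? K)

    product : Subgroup G
    product = closed⇒subgroup inProduct?
      (e , (0 , refl) , subst (_∈ K) (sym (invʳ e)) (has-e K))
      (λ { {x} {y} (c , c∈ , xc⁻¹∈K) (d , d∈@(_ , refl) , yd⁻¹∈K) → c · d , inCyclic-· c∈ d∈ ,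
        subst (_∈ K) (eq x y c d) (closed K _ _ xc⁻¹∈K (∈-normalizer⁻ {K} (normalizes c∈) _ yd⁻¹∈K)) })
      where
      normalizes : ∀ {c} → InCyclic G a c → c ∈ normalizer K
      normalizes (i , refl) = ∈-↑ (normalizer K) a∈N i
      -- Moving c past the K-factor of y conjugates that factor by c, which keeps it in K because c
      -- normalizes K.
      eq : ∀ x y c d → (x · inv c) · conj c (y · inv d) ≡ (x · y) · inv (c · d)
      eq x y c d = begin
        (x · inv c) · ((c · (y · inv d)) · inv c)   ≡⟨ assoc _ _ _ ⟩
        x · (inv c · ((c · (y · inv d)) · inv c))   ≡⟨ cong (λ t → x · (inv c · t)) (assoc _ _ _) ⟩
        x · (inv c · (c · ((y · inv d) · inv c)))   ≡⟨ cong (x ·_) (\\-leftDividesʳ c _) ⟩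
        x · ((y · inv d) · inv c)                   ≡⟨ cong (x ·_) (assoc _ _ _) ⟩
        x · (y · (inv d · inv c))                   ≡⟨ assoc _ _ _ ⟨
        (x · y) · (inv d · inv c)                   ≡⟨ cong ((x · y) ·_) (⁻¹-anti-homo-∙ c d) ⟨
        (x · y) · inv (c · d)                       ∎

    K⊆product : K ⊆ product
    K⊆product x x∈K = fromWitness (e , (0 , refl) ,
      subst (_∈ K) (sym (trans (cong (x ·_) ε⁻¹≈ε) (idʳ x))) x∈K)

    a∈product : a ∈ product
    a∈product = fromWitness (a , inCyclic-refl a , subst (_∈ K) (sym (invʳ a)) (has-e K))

    -- suc ((size ∸ 1) * (i * p)) stands for the exponent 1 - i p, as z ^ (size - 1) = z⁻¹.
    no-pth-root : a ∉ K → ∀ y → y ∈ product → y ↑ p ≢ a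
    no-pth-root a∉K y y∈ yᵖ≡a = impossible (toWitness {a? = inProduct? y} y∈)
      where
      p∤ : ∀ i → ¬ p ∣ suc ((size ∸ 1) * (i * p))
      p∤ i p∣ = nonTrivial⇒≢1 {{prime⇒nonTrivial pp}}
        (∣1⇒≡1 (∣m+n∣m⇒∣n (subst (p ∣_) (+-comm 1 _) p∣) (∣n⇒∣m*n (size ∸ 1) (n∣m*n i))))
      inv-aⁱ : ∀ i → inv (a ↑ i) ≡ y ↑ ((size ∸ 1) * (i * p))
      inv-aⁱ i = begin
        inv (a ↑ i)                     ≡⟨ inv-↑ (a ↑ i) ⟩
        (a ↑ i) ↑ (size ∸ 1)            ≡⟨ cong (λ t → (t ↑ i) ↑ (size ∸ 1)) yᵖ≡a ⟨
        ((y ↑ p) ↑ i) ↑ (size ∸ 1)      ≡⟨ cong (_↑ (size ∸ 1)) (↑-* y i p) ⟨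
        (y ↑ (i * p)) ↑ (size ∸ 1)      ≡⟨ ↑-* y (size ∸ 1) (i * p) ⟨
        y ↑ ((size ∸ 1) * (i * p))      ∎
      impossible : ¬ InProduct y
      impossible (_ , (i , refl) , ya⁻ⁱ∈K) with u , inverse ← ↑-inverse (p∤ i) =
        a∉K (subst (_∈ K) yᵖ≡a (∈-↑ K y∈K p))
        where
        y∈K : y ∈ K
        -- y a⁻ⁱ is a power of y whose exponent is prime to p, so y is in turn a power of it.
        y∈K = subst (_∈ K) (inverse y) (∈-↑ K (subst (_∈ K) (cong (y ·_) (inv-aⁱ i)) ya⁻ⁱ∈K) u)

  -- The two implications

  conj-isOrder : ∀ g {b m} → IsOrder G b m → IsOrder G (conj g b) m
  conj-isOrder g {b} {m} (1≤m , bᵐ≡e , minimal) =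
    1≤m , trans (sym (conj-↑ g b m)) (trans (cong (conj g) bᵐ≡e) (conj-e g)) ,
    λ j 1≤j j<m aʲ≡e → minimal j 1≤j j<m (begin
      b ↑ j                          ≡⟨ conj-inverseˡ g _ ⟨
      conj (inv g) (conj g (b ↑ j))  ≡⟨ cong (conj (inv g)) (trans (conj-↑ g b j) aʲ≡e) ⟩
      conj (inv g) e                 ≡⟨ conj-e _ ⟩
      e                              ∎)

  -- Conjugation commutes with powers, so the generator decides. Contrapositively, non-normality
  -- shows in a conjugate of the generator itself.
  normalCyclic : ∀ {y} → (∀ g → InCyclic G y (conj g y)) → NormalCyclic G y
  normalCyclic {y} conj∈ g h (i , refl) with j , eq ← conj∈ g =
    i * j , trans (conj-↑ g y i) (trans (cong (_↑ i) eq) (sym (↑-* y i j)))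

  PropP⁺⇒¬normal : PropP⁺ p G → ∃ λ x → ¬ NormalCyclic G (x ↑ p)
  PropP⁺⇒¬normal (a , _ , (g , refl) , H , a∈H , b∈H , _ , no-root , 0<roots , _)
    with x , x∈H , xᵖ≡b ← count-pos⁻¹ (root? H p (conj g a)) (subst (0 <_) (roots≡count H p _) 0<roots)
    -- Conjugating x ^ p = g a g⁻¹ back by `inv g` returns a, which normality makes a power of x ^
    -- p.
    = x , λ normal → root-of-a (normal (inv g) (conj g a) (1 , trans (sym xᵖ≡b) (sym (↑-1 _))))
    where
    root-of-a : ¬ InCyclic G (x ↑ p) (conj (inv g) (conj g a))
    root-of-a (i , eq) = <⇒≢ (count-pos (root? H p a) (x ↑ i) (∈-↑ H x∈H i , (begin
      (x ↑ i) ↑ p                  ≡⟨ ↑-comm x i p ⟩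
      (x ↑ p) ↑ i                  ≡⟨ eq ⟨
      conj (inv g) (conj g a)      ≡⟨ conj-inverseˡ g a ⟩
      a                            ∎))) (sym (trans (sym (roots≡count H p a)) no-root))

  ¬normal⇒PropP⁺ : (∃ λ x → ¬ NormalCyclic G (x ↑ p)) → PropP⁺ p G
  ¬normal⇒PropP⁺ (x , ¬normal)
    with g , a∉⟨b⟩ ← ¬∀⟶∃¬ size _ (λ g → inCyclic? (x ↑ p) (conj g (x ↑ p))) (¬normal ∘ normalCyclic)
    with K , ⟨x⟩⊆K , a∉K , a∈N ← normalizing-extension (cyclic x) {conj g (x ↑ p)}
           (a∉⟨b⟩ ∘ conj-of-pth-power x g ∘ toWitness)
    -- As a = g b g⁻¹, the element that conjugates a to b is `inv g`.
    = a , b , (inv g , sym (conj-inverseˡ g b)) , product , a∈product , b∈H ,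
      (_ , conj-isOrder g (proj₂ (order b)) , proj₂ (order b)) ,
      trans (roots≡count product p a) (count-none (root? product p a) λ y (y∈ , yᵖ≡a) → no-pth-root a∉K y y∈ yᵖ≡a) ,
      subst (0 <_) (sym (roots≡count product p b)) (count-pos (root? product p b) x (x∈H , refl)) ,
      -- Since 0 < l < p, the prime p does not divide l, and both counts equal 1.
      λ l 1<l l<p _ → let p∤l = >⇒∤ {{>-nonZero (<⇒≤ 1<l)}} l<p in
        trans (roots-unique product p∤l a∈product) (sym (roots-unique product p∤l b∈H))
    where
    b = x ↑ p
    a = conj g b
    open Extension K a a∈N
    x∈H : x ∈ product
    x∈H = K⊆product x (⟨x⟩⊆K x (fromWitness (inCyclic-refl x)))
    b∈H : b ∈ product
    b∈H = ∈-↑ product x∈H p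

theorem4p11 : (p : ℕ) → Prime p → (G⁺ : FinGroup) → IsPGroup p G⁺ →
    (PropP⁺ p G⁺ ⇔ (∃[ x ] ¬ NormalCyclic G⁺ (pow G⁺ x p)))
theorem4p11 p pp G⁺ (r , size≡pʳ) = mk⇔ PropP⁺⇒¬normal ¬normal⇒PropP⁺
  where open PGroup pp G⁺ r size≡pʳ
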